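{- For every finite simple graph $G$ there exists a (not necessarily connected) supergraceful graph $H$ containing a subgraph isomorphic to $G$.
   Context: For a graph $H$ with $p$ nodes and $q$ edges, a total labeling is a map $\varphi: V(H) \to \{1,\dots,p+q\}$ such that the $p$ node labels $\varphi(x)$ and the $q$ edge labels $|\varphi(x)-\varphi(y)|$, $xy \in E(H)$, are all pairwise distinct, together forming exactly $\{1,\dots,p+q\}$; $H$ is supergraceful if it admits a total labeling. -}

module Defs where

open import Data.Fin using (Fin; _<?_)
open import Data.Fin.Subset using (Subset; _∈_)
open import Data.List using (List; _++_; allFin; cartesianProduct; filter; length; map)
open import Data.List.Membership.Propositional renaming (_∈_ to _∈ˡ_) using ()
open import Data.List.Relation.Unary.Unique.Propositional using (Unique)
open import Data.Nat using (ℕ; _+_; _≤_; ∣_-_∣)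
open import Data.Product using (∃; _×_; proj₁; proj₂)
open import Function.Bundles using (_↔_; _⇔_; Inverse)
open import Level using (0ℓ)
open import Relation.Binary.Core using (Rel)
open import Relation.Binary.Definitions using (Decidable; Symmetric)
open import Relation.Nullary using (¬_)
open import Relation.Nullary.Decidable using (_×-dec_)

record SimpleGraph (V : Set) : Set₁ where
  field
    Adj    : Rel V 0ℓ
    symm   : Symmetric Adj
    irrefl : ∀ {x} → ¬ Adj x x
    adj?   : Decidable Adj

-- Finite graphs have vertex set Fin n; adjacency is decidable so that the
-- edges can be counted.
FinGraph : ℕ → Set₁
FinGraph n = SimpleGraph (Fin n)

record _≅_ {V W : Set} (G : SimpleGraph V) (K : SimpleGraph W) : Set where
  private
    module G = SimpleGraph G
    module K = SimpleGraph K
  field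
    bijection : V ↔ W
  open Inverse bijection public using (to)
  field
    adj⇔ : ∀ x y → G.Adj x y ⇔ K.Adj (to x) (to y)

-- Not necessarily induced or spanning.
record Subgraph {n : ℕ} (H : FinGraph n) : Set₁ where
  field
    vertices : Subset n

  -- Membership in a Subset is proof-irrelevant, so each vertex occurs once.
  Vertex : Set
  Vertex = ∃ λ v → v ∈ vertices

  field
    graph : SimpleGraph Vertex
    adj⊆  : ∀ {x y} → SimpleGraph.Adj graph x y →
            SimpleGraph.Adj H (proj₁ x) (proj₁ y)

-- Each edge xy is listed exactly once, as the pair with x < y.
edges : ∀ {n} → FinGraph n → List (Fin n × Fin n)
edges {n} H =
  filter (λ e → (proj₁ e <? proj₂ e) ×-dec SimpleGraph.adj? H (proj₁ e) (proj₂ e))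
         (cartesianProduct (allFin n) (allFin n))

size : ∀ {n} → FinGraph n → ℕ
size H = length (edges H)

labels : ∀ {n} → FinGraph n → (Fin n → ℕ) → List ℕ
labels {n} H φ =
  map φ (allFin n) ++ map (λ e → ∣ φ (proj₁ e) - φ (proj₂ e) ∣) (edges H)

record IsTotalLabeling {p : ℕ} (H : FinGraph p) (φ : Fin p → ℕ) : Set where
  field
    range    : ∀ x → 1 ≤ φ x × φ x ≤ p + size H
    distinct : Unique (labels H φ)
    exact    : ∀ k → k ∈ˡ labels H φ ⇔ (1 ≤ k × k ≤ p + size H)

Supergraceful : ∀ {p} → FinGraph p → Set
Supergraceful H = ∃ λ φ → IsTotalLabeling H φ

{-# OPTIONS --safe #-}

-- Label vertex i of G by 3^i. Since 3^a + 3^b < 3^c whenever a, b < c, these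
-- labels and all their pairwise differences are distinct. Every number up to
-- 3^n that is not yet used becomes the label of a new isolated vertex, which
-- adds exactly one label and no differences.

module Submission where

open import Defs
open import Data.Nat using (ℕ)
open import Data.Product using (Σ; ∃; _×_)
open import Data.Empty using (⊥)
open import Data.Fin using (Fin; toℕ; splitAt; _↑ˡ_; _↑ʳ_; zero; suc)
  renaming (_<_ to _<ᶠ_; _<?_ to _<?ᶠ_)
open import Data.Fin.Properties using
  (toℕ<n; toℕ-injective; toℕ-↑ˡ; ↑ˡ-injective; splitAt-↑ˡ;
   splitAt-↑ʳ; splitAt⁻¹-↑ˡ; splitAt⁻¹-↑ʳ)
import Data.Fin.Subset as Subset
open import Data.Fin.Subset.Properties using (∈⊤; ∉⊥)
open import Data.List using
  (List; []; _∷_; _++_; allFin; applyUpTo; cartesianProduct; filter; length; lookup; map; tabulate)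
open import Data.List.Membership.DecPropositional Data.Nat._≟_ using (_∈?_)
open import Data.List.Membership.Propositional using (_∈_)
open import Data.List.Membership.Propositional.Properties using
  (∈-++⁺ˡ; ∈-++⁺ʳ; ∈-++⁻; ∈-allFin; ∈-applyUpTo⁺; ∈-applyUpTo⁻;
   ∈-cartesianProduct⁺; ∈-filter⁺; ∈-filter⁻; ∈-map⁺; ∈-map⁻)
open import Data.List.Membership.Propositional.Properties.WithK using (unique∧set⇒bag)
open import Data.List.Properties using
  (length-++; length-applyUpTo; length-map; length-tabulate; map-∘;
   map-cong; map-tabulate; tabulate-cong; tabulate-lookup; ++-assoc)
open import Data.List.Relation.Binary.BagAndSetEquality using (∼bag⇒↭)
open import Data.List.Relation.Binary.Permutation.Propositional using
  (_↭_; ↭-sym; ↭-trans; ↭-reflexive; ↭⇒↭ₛ; module PermutationReasoning)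
open import Data.List.Relation.Binary.Permutation.Propositional.Properties as Perm using
  (∈-resp-↭; ↭-length; ++⁺ˡ)
import Data.List.Relation.Binary.Permutation.Setoid.Properties as PermSetoid
open import Data.List.Relation.Unary.All as All using ()
import Data.List.Relation.Unary.All.Properties as All
open import Data.List.Relation.Unary.AllPairs using ([]; _∷_)
open import Data.List.Relation.Unary.Any using (here; there)
open import Data.List.Relation.Unary.Unique.Propositional using (Unique)
import Data.List.Relation.Unary.Unique.Propositional.Properties as Unique
open import Data.Nat using (zero; suc; _+_; _^_; _≤_; _<_; ∣_-_∣; s≤s; z≤n; s≤s⁻¹)
open import Data.Nat.Properties
open import Data.Product using (_,_; proj₁; proj₂)
open import Data.Sum using (_⊎_; inj₁; inj₂; [_,_]′)
open import Data.Vec using () renaming (_++_ to _++ᵛ_)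
open import Data.Vec.Properties using
  ([]=⇒lookup; lookup⇒[]=; lookup-++ˡ; lookup-++ʳ)
open import Data.Vec.Properties.WithK using ([]=-irrelevant)
open import Function using (_∘_; id)
open import Function.Bundles using (_⇔_; mk⇔; mk↔ₛ′; Equivalence)
open import Relation.Binary.Definitions using (tri<; tri≈; tri>)
open import Relation.Binary.PropositionalEquality
open import Relation.Nullary using (¬_; Dec; yes; no; ¬?; contradiction; _×-dec_)

-- Duplicate-free lists and the interval from 1 to `N`.

module _ {A : Set} where

  -- Injectivity is asked only on members of the list. The difference map separates the edges,
  -- listed with the smaller end first, but not all pairs: swapping the ends keeps the difference.
  Unique-map⁺ : ∀ {B : Set} {f : A → B} {xs} →
                (∀ {x y} → x ∈ xs → y ∈ xs → f x ≡ f y → x ≡ y) →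
                Unique xs → Unique (map f xs)
  Unique-map⁺ inj []         = []
  Unique-map⁺ inj (x∉ ∷ xs!) =
    All.map⁺ (All.tabulate λ y∈ eq → All.lookup x∉ y∈ (inj (here refl) (there y∈) eq))
    ∷ Unique-map⁺ (λ x∈ y∈ → inj (there x∈) (there y∈)) xs!

  -- In a duplicate-free list an element has at most one membership proof, so equality as sets is
  -- already equality as bags.
  Unique∧set⇒↭ : ∀ {xs ys : List A} → Unique xs → Unique ys →
                 (∀ {x} → x ∈ xs → x ∈ ys) → (∀ {x} → x ∈ ys → x ∈ xs) → xs ↭ ys
  Unique∧set⇒↭ xs! ys! xs⊆ys ys⊆xs = ∼bag⇒↭ (unique∧set⇒bag xs! ys! (mk⇔ xs⊆ys ys⊆xs))

  tabulate-++ : ∀ m {r} (f : Fin (m + r) → A) →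
                tabulate f ≡ tabulate (f ∘ (_↑ˡ r)) ++ tabulate (f ∘ (m ↑ʳ_))
  tabulate-++ zero    f = refl
  tabulate-++ (suc m) f = cong (f zero ∷_) (tabulate-++ m (f ∘ suc))

∈-range⇔ : ∀ N {k} → k ∈ applyUpTo suc N ⇔ (1 ≤ k × k ≤ N)
∈-range⇔ N {k} = mk⇔ to from
  where
  to : k ∈ applyUpTo suc N → 1 ≤ k × k ≤ N
  to k∈ with _ , i<N , refl ← ∈-applyUpTo⁻ suc k∈ = s≤s z≤n , i<N
  from : 1 ≤ k × k ≤ N → k ∈ applyUpTo suc N
  from (s≤s _ , k≤N) = ∈-applyUpTo⁺ suc k≤N

range-! : ∀ N → Unique (applyUpTo suc N)
range-! N = Unique.applyUpTo⁺₁ suc N λ i<j _ → <⇒≢ i<j ∘ suc-injective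

-- Edge lists and label lists of a finite graph.

distance : ∀ {n} → (Fin n → ℕ) → Fin n × Fin n → ℕ
distance φ e = ∣ φ (proj₁ e) - φ (proj₂ e) ∣

module _ {n} (G : FinGraph n) where
  open SimpleGraph G

  private
    edge? : (e : Fin n × Fin n) → Dec (proj₁ e <ᶠ proj₂ e × Adj (proj₁ e) (proj₂ e))
    edge? e = (proj₁ e <?ᶠ proj₂ e) ×-dec adj? (proj₁ e) (proj₂ e)

    pairs = cartesianProduct (allFin n) (allFin n)

  ∈-edges⁺ : ∀ {x y} → x <ᶠ y → Adj x y → (x , y) ∈ edges G
  ∈-edges⁺ x<y xy = ∈-filter⁺ edge? (∈-cartesianProduct⁺ (∈-allFin _) (∈-allFin _)) (x<y , xy)

  ∈-edges⁻ : ∀ {x y} → (x , y) ∈ edges G → x <ᶠ y × Adj x y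
  ∈-edges⁻ e∈ = proj₂ (∈-filter⁻ edge? {xs = pairs} e∈)

  edges-! : Unique (edges G)
  edges-! = Unique.filter⁺ edge? (Unique.cartesianProduct⁺ (Unique.allFin⁺ n) (Unique.allFin⁺ n))

  length-labels : ∀ φ → length (labels G φ) ≡ n + size G
  length-labels φ = trans (length-++ (map φ (allFin n)))
    (cong₂ _+_ (trans (length-map φ (allFin n)) (length-tabulate {n = n} id))
               (length-map (distance φ) (edges G)))

  -- Comparing lengths forces `N` to be `n + size G`. Any convenient `N` can thus be used, and no
  -- edges have to be counted.
  ↭-range⇒IsTotalLabeling : ∀ {φ N} → labels G φ ↭ applyUpTo suc N → IsTotalLabeling G φ
  ↭-range⇒IsTotalLabeling {φ} {N} labels↭
    with refl ← trans (sym (length-labels φ)) (trans (↭-length labels↭) (length-applyUpTo suc N))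
    = record
    { range    = λ x → to (∈-++⁺ˡ (∈-map⁺ φ (∈-allFin x)))
    ; distinct = PermSetoid.Unique-resp-↭ (setoid ℕ) (↭⇒↭ₛ (↭-sym labels↭)) (range-! N)
    ; exact    = λ k → mk⇔ to (∈-resp-↭ (↭-sym labels↭) ∘ Equivalence.from (∈-range⇔ N))
    }
    where
    to : ∀ {k} → k ∈ labels G φ → 1 ≤ k × k ≤ n + size G
    to = Equivalence.to (∈-range⇔ N) ∘ ∈-resp-↭ labels↭

-- Adding isolated vertices.

module _ {n} (G : FinGraph n) (r : ℕ) where
  private module G = SimpleGraph G

  addIsolated : FinGraph (n + r)
  addIsolated = record
    { Adj    = λ x y → Adj′ (splitAt n x) (splitAt n y)
    ; symm   = λ {x} {y} → symm′ (splitAt n x) (splitAt n y)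
    ; irrefl = λ {x} → irrefl′ (splitAt n x)
    ; adj?   = λ x y → adj?′ (splitAt n x) (splitAt n y)
    }
    where
    Adj′ : Fin n ⊎ Fin r → Fin n ⊎ Fin r → Set
    Adj′ (inj₁ i) (inj₁ j) = G.Adj i j
    Adj′ _        _        = ⊥

    symm′ : ∀ x y → Adj′ x y → Adj′ y x
    symm′ (inj₁ _) (inj₁ _) = G.symm

    irrefl′ : ∀ x → ¬ Adj′ x x
    irrefl′ (inj₁ _) = G.irrefl

    adj?′ : ∀ x y → Dec (Adj′ x y)
    adj?′ (inj₁ i) (inj₁ j) = G.adj? i j
    adj?′ (inj₁ _) (inj₂ _) = no id
    adj?′ (inj₂ _) (inj₁ _) = no id
    adj?′ (inj₂ _) (inj₂ _) = no id

  private module H = SimpleGraph addIsolated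

  addIsolated-adj⇔ : ∀ i j → H.Adj (i ↑ˡ r) (j ↑ˡ r) ⇔ G.Adj i j
  addIsolated-adj⇔ i j rewrite splitAt-↑ˡ n i r | splitAt-↑ˡ n j r = mk⇔ id id

  addIsolated-adj⁻ : ∀ {x y} → H.Adj x y →
                     ∃ λ i → ∃ λ j → i ↑ˡ r ≡ x × j ↑ˡ r ≡ y × G.Adj i j
  addIsolated-adj⁻ {x} {y} xy with splitAt n x in eqx | splitAt n y in eqy
  ... | inj₁ i | inj₁ j = i , j , splitAt⁻¹-↑ˡ eqx , splitAt⁻¹-↑ˡ eqy , xy

  private
    include : Fin n × Fin n → Fin (n + r) × Fin (n + r)
    include (i , j) = i ↑ˡ r , j ↑ˡ r

    include-injective : ∀ {e e′} → include e ≡ include e′ → e ≡ e′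
    include-injective eq = cong₂ _,_ (↑ˡ-injective r _ _ (cong proj₁ eq)) (↑ˡ-injective r _ _ (cong proj₂ eq))

  -- Labels matter only up to order, so comparing members suffices and the filtered product need not
  -- be followed entry by entry. Since `_↑ˡ r` keeps `toℕ`, the smaller end of an edge stays the
  -- smaller one.
  edges-addIsolated : edges addIsolated ↭ map include (edges G)
  edges-addIsolated = Unique∧set⇒↭ (edges-! addIsolated)
    (Unique.map⁺ include-injective (edges-! G)) ⊆-to ⊆-from
    where
    ⊆-to : ∀ {e} → e ∈ edges addIsolated → e ∈ map include (edges G)
    ⊆-to e∈
      with x<y , xy ← ∈-edges⁻ addIsolated e∈
      with i , j , refl , refl , ij ← addIsolated-adj⁻ xy
      = ∈-map⁺ include (∈-edges⁺ G (subst₂ _<_ (toℕ-↑ˡ i r) (toℕ-↑ˡ j r) x<y) ij)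

    ⊆-from : ∀ {e} → e ∈ map include (edges G) → e ∈ edges addIsolated
    ⊆-from e∈
      with (i , j) , ij∈ , refl ← ∈-map⁻ include e∈
      with i<j , ij ← ∈-edges⁻ G ij∈
      = ∈-edges⁺ addIsolated (subst₂ _<_ (sym (toℕ-↑ˡ i r)) (sym (toℕ-↑ˡ j r)) i<j)
          (Equivalence.from (addIsolated-adj⇔ i j) ij)

  labels-addIsolated : ∀ φ → labels addIsolated φ ↭
                       labels G (φ ∘ (_↑ˡ r)) ++ tabulate (φ ∘ (n ↑ʳ_))
  labels-addIsolated φ = begin
    map φ (allFin (n + r)) ++ map (distance φ) (edges addIsolated)
      ↭⟨ ++⁺ˡ _ (Perm.map⁺ (distance φ) edges-addIsolated) ⟩
    map φ (allFin (n + r)) ++ map (distance φ) (map include (edges G))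
      ≡⟨ cong₂ _++_ nodes (map-∘ (edges G)) ⟨
    (A ++ R) ++ D
      ≡⟨ ++-assoc A R D ⟩
    A ++ R ++ D
      -- The labels `R` of the new vertices move past the differences `D`, so that `A ++ D` is the
      -- label list of `G`.
      ↭⟨ ++⁺ˡ A (Perm.++-comm R D) ⟩
    A ++ D ++ R
      ≡⟨ ++-assoc A D R ⟨
    (A ++ D) ++ R ∎
    where
    open PermutationReasoning
    A = map (φ ∘ (_↑ˡ r)) (allFin n)
    D = map (distance (φ ∘ (_↑ˡ r))) (edges G)
    R = tabulate (φ ∘ (n ↑ʳ_))
    nodes : A ++ R ≡ map φ (allFin (n + r))
    nodes = trans (cong (_++ R) (map-tabulate {n = n} id (φ ∘ (_↑ˡ r))))
      (sym (trans (map-tabulate {n = n + r} id φ) (tabulate-++ n φ)))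

  original : Subgraph addIsolated
  original = record
    { vertices = Subset.⊤ {n} ++ᵛ Subset.⊥ {r}
    ; graph    = record
      { Adj    = λ x y → H.Adj (proj₁ x) (proj₁ y)
      ; symm   = H.symm
      ; irrefl = H.irrefl
      ; adj?   = λ x y → H.adj? (proj₁ x) (proj₁ y)
      }
    ; adj⊆ = id
    }

  private module K = Subgraph original

  ↑ˡ∈original : ∀ i → i ↑ˡ r Subset.∈ K.vertices
  ↑ˡ∈original i = lookup⇒[]= (i ↑ˡ r) K.vertices
    (trans (lookup-++ˡ (Subset.⊤ {n}) Subset.⊥ i) ([]=⇒lookup (∈⊤ {x = i})))

  original-preimage : (v : K.Vertex) → ∃ λ i → i ↑ˡ r ≡ proj₁ v
  original-preimage (x , x∈) with splitAt n x in eq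
  ... | inj₁ i = i , splitAt⁻¹-↑ˡ eq
  -- An added vertex lies in the `⊥` half of the subset, so its membership would be a member of the
  -- empty subset.
  ... | inj₂ k with refl ← splitAt⁻¹-↑ʳ {n} eq
    = contradiction (lookup⇒[]= k Subset.⊥
        (trans (sym (lookup-++ʳ (Subset.⊤ {n}) Subset.⊥ k)) ([]=⇒lookup x∈))) ∉⊥

  original≅ : K.graph ≅ G
  original≅ = record
    { bijection = mk↔ₛ′ (proj₁ ∘ original-preimage) (λ i → i ↑ˡ r , ↑ˡ∈original i)
        (λ i → ↑ˡ-injective r _ _ (proj₂ (original-preimage (i ↑ˡ r , ↑ˡ∈original i))))
        from∘to
    ; adj⇔ = adj⇔
    }
    where
    from∘to : ∀ v → (proj₁ (original-preimage v) ↑ˡ r , ↑ˡ∈original (proj₁ (original-preimage v))) ≡ v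
    -- A vertex carries its membership proof, so the round trip must also match the two proofs;
    -- irrelevance does this.
    from∘to v@(_ , x∈) with i , refl ← original-preimage v =
      cong (_ ,_) ([]=-irrelevant (↑ˡ∈original i) x∈)

    adj⇔ : ∀ x y → H.Adj (proj₁ x) (proj₁ y) ⇔
           G.Adj (proj₁ (original-preimage x)) (proj₁ (original-preimage y))
    adj⇔ x@(_ , _) y@(_ , _) with i , refl ← original-preimage x | j , refl ← original-preimage y =
      addIsolated-adj⇔ i j

-- Any bound `N` on the labels of `G` will do. Appending the missed numbers to these labels gives a
-- duplicate-free list with the same members as the interval, hence a permutation of it.
addIsolated-supergraceful :
  ∀ {n} (G : FinGraph n) (ψ : Fin n → ℕ) N → Unique (labels G ψ) →
  (∀ {k} → k ∈ labels G ψ → 1 ≤ k × k ≤ N) →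
  ∃ λ r → Supergraceful (addIsolated G r)
addIsolated-supergraceful {n} G ψ N L! L⊆ =
  length unused , φ , ↭-range⇒IsTotalLabeling H labels↭
  where
  unused? = λ k → ¬? (k ∈? labels G ψ)
  unused = filter unused? (applyUpTo suc N)
  H = addIsolated G (length unused)

  φ : Fin (n + length unused) → ℕ
  φ = [ ψ , lookup unused ]′ ∘ splitAt n

  ψ≗φ : ∀ i → ψ i ≡ φ (i ↑ˡ length unused)
  ψ≗φ i = cong [ ψ , lookup unused ]′ (sym (splitAt-↑ˡ n i (length unused)))

  labels≡ : labels G (φ ∘ (_↑ˡ length unused)) ≡ labels G ψ
  labels≡ = sym (cong₂ _++_ (map-cong ψ≗φ (allFin n))
    (map-cong (λ e → cong₂ ∣_-_∣ (ψ≗φ (proj₁ e)) (ψ≗φ (proj₂ e))) (edges G)))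

  unused≡ : tabulate (φ ∘ (n ↑ʳ_)) ≡ unused
  unused≡ = trans (tabulate-cong λ k → cong [ ψ , lookup unused ]′ (splitAt-↑ʳ n (length unused) k))
                  (tabulate-lookup unused)

  used++unused↭ : labels G ψ ++ unused ↭ applyUpTo suc N
  used++unused↭ = Unique∧set⇒↭
    (Unique.++⁺ L! (Unique.filter⁺ unused? (range-! N))
      λ (k∈L , k∈u) → proj₂ (∈-filter⁻ unused? {xs = applyUpTo suc N} k∈u) k∈L)
    (range-! N)
    ([ Equivalence.from (∈-range⇔ N) ∘ L⊆ , proj₁ ∘ ∈-filter⁻ unused? ]′ ∘ ∈-++⁻ (labels G ψ))
    split
    where
    split : ∀ {k} → k ∈ applyUpTo suc N → k ∈ labels G ψ ++ unused
    split {k} k∈ with k ∈? labels G ψ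
    ... | yes k∈L = ∈-++⁺ˡ k∈L
    ... | no  k∉L = ∈-++⁺ʳ (labels G ψ) (∈-filter⁺ unused? k∈ k∉L)

  labels↭ : labels H φ ↭ applyUpTo suc N
  labels↭ = ↭-trans (labels-addIsolated G (length unused) φ)
    (↭-trans (↭-reflexive (cong₂ _++_ labels≡ unused≡)) used++unused↭)

-- Differences of powers of three.

-- The left side is at most twice the power just below `3 ^ c`, which is three times that power.
-- Base 2 would fail: a power and its double differ by a power.
3^a+3^b<3^c : ∀ {a b c} → a < c → b < c → 3 ^ a + 3 ^ b < 3 ^ c
3^a+3^b<3^c {a} {b} {suc c} a<c b<c = begin-strict
  3 ^ a + 3 ^ b                     ≤⟨ +-mono-≤ (^-monoʳ-≤ 3 (s≤s⁻¹ a<c)) (^-monoʳ-≤ 3 (s≤s⁻¹ b<c)) ⟩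
  -- `3 ^ suc c` unfolds to `3 ^ c + (3 ^ c + (3 ^ c + 0))`, whence the summand 0 in the positivity
  -- proof.
  3 ^ c + 3 ^ c                     <⟨ +-monoʳ-< (3 ^ c) (m<m+n (3 ^ c) (≤-trans (m^n>0 3 c) (m≤m+n (3 ^ c) 0))) ⟩
  3 ^ suc c                         ∎
  where open ≤-Reasoning

-- Turns equations between differences into equations between sums, to which `3^a+3^b<3^c` applies.
gap+3^i≡3^j : ∀ {i j} → i < j → ∣ 3 ^ i - 3 ^ j ∣ + 3 ^ i ≡ 3 ^ j
gap+3^i≡3^j {i} {j} i<j =
  trans (cong (_+ 3 ^ i) (m≤n⇒∣m-n∣≡n∸m 3^i≤3^j)) (m∸n+n≡m 3^i≤3^j)
  where 3^i≤3^j = ^-monoʳ-≤ 3 (<⇒≤ i<j)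

3^-injective : ∀ {i j} → 3 ^ i ≡ 3 ^ j → i ≡ j
3^-injective {i} {j} eq with <-cmp i j
... | tri< i<j _ _ = contradiction eq (<⇒≢ (^-monoʳ-< 3 (s≤s (s≤s z≤n)) i<j))
... | tri≈ _ i≡j _ = i≡j
... | tri> _ _ j<i = contradiction (sym eq) (<⇒≢ (^-monoʳ-< 3 (s≤s (s≤s z≤n)) j<i))

-- Equality would give `3 ^ k + 3 ^ i ≡ 3 ^ j`. For `k < j` the left side is too small, both
-- exponents being below `j`; otherwise it is too large, as `3 ^ i` is positive.
gap≢power : ∀ {i j} k → i < j → ∣ 3 ^ i - 3 ^ j ∣ ≢ 3 ^ k
gap≢power {i} {j} k i<j eq with k <? j
... | yes k<j = <⇒≢ (3^a+3^b<3^c k<j i<j) (trans (cong (_+ 3 ^ i) (sym eq)) (gap+3^i≡3^j i<j))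
... | no  k≮j = <⇒≢ (<-≤-trans (m<m+n (3 ^ j) (m^n>0 3 i)) (+-monoˡ-≤ (3 ^ i) (^-monoʳ-≤ 3 (≮⇒≥ k≮j))))
  (trans (sym (gap+3^i≡3^j i<j)) (cong (_+ 3 ^ i) eq))

-- Adding `3 ^ i + 3 ^ k` to both sides removes the subtractions. If `j < l`, then both exponents on
-- the left of `sums≡` are below `l`, so that side is too small; `l < j` is symmetric. Hence
-- `j ≡ l`, and cancelling leaves `3 ^ k ≡ 3 ^ i`.
gap-injective : ∀ {i j k l} → i < j → k < l →
                ∣ 3 ^ i - 3 ^ j ∣ ≡ ∣ 3 ^ k - 3 ^ l ∣ → i ≡ k × j ≡ l
gap-injective {i} {j} {k} {l} i<j k<l eq = by-cmp
  where
  sums≡ : 3 ^ j + 3 ^ k ≡ 3 ^ l + 3 ^ i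
  sums≡ = begin
    3 ^ j + 3 ^ k                         ≡⟨ cong (_+ 3 ^ k) (gap+3^i≡3^j i<j) ⟨
    ∣ 3 ^ i - 3 ^ j ∣ + 3 ^ i + 3 ^ k     ≡⟨ cong (λ d → d + 3 ^ i + 3 ^ k) eq ⟩
    ∣ 3 ^ k - 3 ^ l ∣ + 3 ^ i + 3 ^ k     ≡⟨ +-assoc _ (3 ^ i) (3 ^ k) ⟩
    ∣ 3 ^ k - 3 ^ l ∣ + (3 ^ i + 3 ^ k)   ≡⟨ cong (∣ 3 ^ k - 3 ^ l ∣ +_) (+-comm (3 ^ i) (3 ^ k)) ⟩
    ∣ 3 ^ k - 3 ^ l ∣ + (3 ^ k + 3 ^ i)   ≡⟨ +-assoc _ (3 ^ k) (3 ^ i) ⟨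
    ∣ 3 ^ k - 3 ^ l ∣ + 3 ^ k + 3 ^ i     ≡⟨ cong (_+ 3 ^ i) (gap+3^i≡3^j k<l) ⟩
    3 ^ l + 3 ^ i                         ∎
    where open ≡-Reasoning

  by-cmp : i ≡ k × j ≡ l
  by-cmp with <-cmp j l
  ... | tri< j<l _ _  = contradiction sums≡ (<⇒≢ (<-≤-trans (3^a+3^b<3^c j<l k<l) (m≤m+n _ _)))
  ... | tri> _ _ l<j  = contradiction (sym sums≡) (<⇒≢ (<-≤-trans (3^a+3^b<3^c l<j i<j) (m≤m+n _ _)))
  ... | tri≈ _ refl _ = 3^-injective (sym (+-cancelˡ-≡ (3 ^ j) _ _ sums≡)) , refl

-- Labeling by powers of three.

module _ {n} (G : FinGraph n) where
  private
    ψ : Fin n → ℕ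
    ψ i = 3 ^ toℕ i

  powerLabels-! : Unique (labels G ψ)
  powerLabels-! = Unique.++⁺
    (Unique.map⁺ (toℕ-injective ∘ 3^-injective) (Unique.allFin⁺ n))
    (Unique-map⁺ distance-injective (edges-! G))
    disjoint
    where
    distance-injective : ∀ {e e′} → e ∈ edges G → e′ ∈ edges G → distance ψ e ≡ distance ψ e′ → e ≡ e′
    distance-injective e∈ e′∈ eq
      with eq₁ , eq₂ ← gap-injective (proj₁ (∈-edges⁻ G e∈)) (proj₁ (∈-edges⁻ G e′∈)) eq
      = cong₂ _,_ (toℕ-injective eq₁) (toℕ-injective eq₂)

    disjoint : ∀ {k} → ¬ (k ∈ map ψ (allFin n) × k ∈ map (distance ψ) (edges G))
    disjoint (k∈A , k∈D)
      with i , _ , refl ← ∈-map⁻ ψ k∈A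
      with e , e∈ , eq ← ∈-map⁻ (distance ψ) k∈D
      = gap≢power (toℕ i) (proj₁ (∈-edges⁻ G e∈)) (sym eq)

  powerLabels-range : ∀ {k} → k ∈ labels G ψ → 1 ≤ k × k ≤ 3 ^ n
  powerLabels-range k∈ with ∈-++⁻ (map ψ (allFin n)) k∈
  ... | inj₁ k∈A with i , _ , refl ← ∈-map⁻ ψ k∈A =
    m^n>0 3 (toℕ i) , ^-monoʳ-≤ 3 (<⇒≤ (toℕ<n i))
  ... | inj₂ k∈D with (i , j) , e∈ , refl ← ∈-map⁻ (distance ψ) k∈D =
    -- A zero difference would make the two powers, hence the exponents, equal.
    n≢0⇒n>0 (<⇒≢ i<j ∘ 3^-injective ∘ ∣m-n∣≡0⇒m≡n) ,
    (begin
      ∣ ψ i - ψ j ∣         ≤⟨ m≤m+n _ (ψ i) ⟩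
      ∣ ψ i - ψ j ∣ + ψ i   ≡⟨ gap+3^i≡3^j i<j ⟩
      ψ j                   ≤⟨ ^-monoʳ-≤ 3 (<⇒≤ (toℕ<n j)) ⟩
      3 ^ n                 ∎)
    where
    open ≤-Reasoning
    i<j = proj₁ (∈-edges⁻ G e∈)

theorem8p7 : (n : ℕ) (G : FinGraph n) →
    ∃ λ (p : ℕ) → Σ (FinGraph p) λ H →
    Supergraceful H × Σ (Subgraph H) λ K → Subgraph.graph K ≅ G
theorem8p7 n G
  -- The bound `3 ^ n` is generous, as vertex labels stop at the power before it, but it needs no
  -- separate case for `n = 0`; there `H` is a single vertex labeled 1.
  with r , supergraceful ← addIsolated-supergraceful G _ (3 ^ n) (powerLabels-! G) (powerLabels-range G)
  = n + r , addIsolated G r , supergraceful , original G r , original≅ G r
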